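{- A permutation $\pi$ is $2$-pass sortable (i.e., $t(\pi)\le 1$) if and only if $\pi$ avoids each of the permutations $$24153,\ 24513,\ 24531,\ 34251,\ 35241,\ 42513,\ 42531,\ 45231,\ 261453,\ 231564,\ 523164.$$
   Context: A permutation $\rho$ avoids $\sigma$ if it does not contain $\sigma$ as a pattern (no subsequence of $\rho$ has the same relative order as $\sigma$). Multi-pass stack sorting: in a pass, the entries of the current input are pushed one at a time, in order, onto a stack; whenever the top of the stack is the smallest value not yet output, it is popped to the output (repeatedly); entries are never popped otherwise. When all input entries have been pushed and no pop is possible, if the stack is nonempty the remaining entries are returned to the input in their original relative order and a new pass begins. A permutation is $k$-pass sortable if it is sorted (output $1,\dots,n$) using at most $k$ passes; its tier $t(\pi)$ is one less than the minimum number of passes needed. -}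

module Defs where

open import Data.Nat using (ℕ; zero; suc; _<_; _≟_)
open import Data.List using (List; []; _∷_; _++_; reverse; length; map; upTo)
open import Data.List.Relation.Binary.Sublist.Propositional using (_⊆_)
open import Data.List.Relation.Binary.Pointwise using (Pointwise)
open import Data.List.Relation.Binary.Permutation.Propositional using (_↭_)
open import Data.Product using (_×_; _,_; ∃; proj₁)
open import Data.Unit using (⊤)
open import Data.Empty using (⊥)
open import Relation.Nullary using (¬_; yes; no)
open import Relation.Binary.PropositionalEquality using (_≡_)
open import Function.Bundles using (_⇔_)

oneTo : ℕ → List ℕ
oneTo n = map suc (upTo n)

IsPerm : List ℕ → Set
IsPerm π = π ↭ oneTo (length π)

SameOrder : List ℕ → List ℕ → Set
SameOrder [] [] = ⊤
SameOrder [] (_ ∷ _) = ⊥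
SameOrder (_ ∷ _) [] = ⊥
SameOrder (x ∷ xs) (y ∷ ys) =
  Pointwise (λ x' y' → ((x < x') ⇔ (y < y')) × ((x' < x) ⇔ (y' < y))) xs ys
  × SameOrder xs ys

Contains : List ℕ → List ℕ → Set
Contains ρ σ = ∃ λ ys → ys ⊆ ρ × SameOrder ys σ

Avoids : List ℕ → List ℕ → Set
Avoids ρ σ = ¬ Contains ρ σ

-- State of the sorting machine during a pass:
--   nxt   : smallest value not yet output (output is always 1,2,...,nxt-1)
--   stack : top first
--   out   : output produced so far
record State : Set where
  constructor st
  field
    nxt   : ℕ
    stack : List ℕ
    out   : List ℕ
open State public

popAll : ℕ → List ℕ → List ℕ → State
popAll n [] out = st n [] out
popAll n (x ∷ s) out with x ≟ n
... | yes _ = popAll (suc n) s (out ++ (x ∷ []))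
... | no _  = st n (x ∷ s) out

pushAll : State → List ℕ → State
pushAll σ [] = σ
pushAll (st n s out) (x ∷ xs) = pushAll (popAll n (x ∷ s) out) xs

-- one pass: returns the new state; the remaining stack entries go back to
-- the input in their original relative order (bottom of stack first = reverse)
record Config : Set where
  constructor cfg
  field
    cnxt   : ℕ
    input  : List ℕ
    output : List ℕ
open Config public

pass : Config → Config
pass (cfg n inp out) with pushAll (st n [] out) inp
... | st n' s out' = cfg n' (reverse s) out'

passes : ℕ → Config → Config
passes zero c = c
passes (suc k) c = passes k (pass c)

run : ℕ → List ℕ → Config
run k π = passes k (cfg 1 π [])

-- π is k-pass sortable: after (at most) k passes the output is 1,2,...,n
-- (extra passes on empty input do nothing, so "at most k" = "exactly k")
Sortable : ℕ → List ℕ → Set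
Sortable k π = output (run k π) ≡ oneTo (length π)

{-# OPTIONS --safe #-}
module Submission where

-- Call k separated if k + 1 precedes k with some c > k + 1 between them.  When k is output and
-- k + 1 is already on the stack, k + 1 can follow at once unless something larger lies on top of
-- it, in which case it stays buried for the rest of the pass.  So each separated k ends exactly
-- one pass and nothing else does: π is 2-pass sortable iff at most one k is separated.  For
-- b c a forming a 231 there is a separated k with a ≤ k < b, hence two separated values amount
-- to two occurrences b c a and b′ c′ a′ of 231 with b ≤ a′.  The eleven patterns are the
-- minimal ways to interleave two such occurrences, which may share letters.

open import Defs
open import Data.Empty using (⊥-elim)
open import Data.Fin as Fin using (Fin; zero; suc; toℕ; #_)
import Data.Fin.Properties as Fin
open import Data.Nat using (ℕ; zero; suc; _≤_; _<_; _≤?_; _<?_; _≟_; z≤n; s≤s; z<s; s<s; s<s⁻¹; s≤s⁻¹)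
open import Data.List using (List; []; _∷_; _++_; map; lookup; length; filter; reverse; zip; upTo)
open import Data.List.Properties
open import Data.List.Membership.Propositional using (_∈_; _∉_; lose)
open import Data.List.Membership.Propositional.Properties
open import Data.List.Membership.DecPropositional _≟_ using (_∈?_)
open import Data.List.Relation.Binary.Permutation.Propositional using (↭-sym; ↭⇒↭ₛ)
open import Data.List.Relation.Binary.Permutation.Propositional.Properties using (∈-resp-↭)
import Data.List.Relation.Binary.Permutation.Setoid.Properties as Permutationₛ
open import Data.List.Relation.Binary.Pointwise as Pointwise using (Pointwise; []; _∷_)
open import Data.List.Relation.Binary.Sublist.Propositional
  using (_⊆_; []; _∷ʳ_; _∷_; minimum; from∈; to∈; ⊆-trans)
import Data.List.Relation.Binary.Sublist.Propositional as Sublist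
open import Data.List.Relation.Binary.Sublist.DecPropositional _≟_ using (_⊆?_)
open import Data.List.Relation.Binary.Sublist.Propositional.Properties
  using (All-resp-⊆; filter⁺; filter-⊆; ++⁺; reverse⁺; reverse⁻)
open import Data.List.Relation.Unary.All as All using (All; []; _∷_)
import Data.List.Relation.Unary.All.Properties as All
open import Data.List.Relation.Unary.Any using (Any; here; there)
import Data.List.Relation.Unary.Any.Properties as Any
open import Data.List.Relation.Unary.AllPairs as AllPairs using (AllPairs; []; _∷_)
import Data.List.Relation.Unary.AllPairs.Properties as AllPairs
open import Data.List.Relation.Unary.Linked using (Linked; []; [-]; _∷_)
open import Data.List.Relation.Unary.Linked.Properties using (Linked⇒AllPairs)
open import Data.List.Relation.Unary.Unique.Propositional using (Unique)
import Data.List.Relation.Unary.Unique.Propositional.Properties as Unique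
open import Data.Nat.Properties
open import Data.Product using (_×_; _,_; ∃; proj₁; proj₂)
open import Data.Sum using (inj₁; inj₂)
open import Function using (_∘_; case_of_)
open import Function.Bundles using (_⇔_; mk⇔; Equivalence)
open import Relation.Binary.Definitions using (tri<; tri≈; tri>)
open import Relation.Binary.PropositionalEquality
open import Relation.Nullary using (Dec; ¬_; yes; no; contradiction)
open import Relation.Nullary.Decidable using (True; toWitness; _×-dec_)

-- The eleven patterns and pairs of 231-occurrences

patterns : List (List ℕ)
patterns =
    (2 ∷ 4 ∷ 1 ∷ 5 ∷ 3 ∷ [])
  ∷ (2 ∷ 4 ∷ 5 ∷ 1 ∷ 3 ∷ [])
  ∷ (2 ∷ 4 ∷ 5 ∷ 3 ∷ 1 ∷ [])
  ∷ (3 ∷ 4 ∷ 2 ∷ 5 ∷ 1 ∷ [])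
  ∷ (3 ∷ 5 ∷ 2 ∷ 4 ∷ 1 ∷ [])
  ∷ (4 ∷ 2 ∷ 5 ∷ 1 ∷ 3 ∷ [])
  ∷ (4 ∷ 2 ∷ 5 ∷ 3 ∷ 1 ∷ [])
  ∷ (4 ∷ 5 ∷ 2 ∷ 3 ∷ 1 ∷ [])
  ∷ (2 ∷ 6 ∷ 1 ∷ 4 ∷ 5 ∷ 3 ∷ [])
  ∷ (2 ∷ 3 ∷ 1 ∷ 5 ∷ 6 ∷ 4 ∷ [])
  ∷ (5 ∷ 2 ∷ 3 ∷ 1 ∷ 6 ∷ 4 ∷ [])
  ∷ []

record Occ231 (π : List ℕ) (b c a : ℕ) : Set where
  constructor occ
  field
    a<b  : a < b
    b<c  : b < c
    word : b ∷ c ∷ a ∷ [] ⊆ π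

-- The inequality `b ≤ a′` is weak so that one letter can be the 2 of the lower occurrence and the 1
-- of the upper one, as in 34251 with 251 and 342.
DoubleOcc : List ℕ → Set
DoubleOcc π = ∃ λ b → ∃ λ c → ∃ λ a → ∃ λ b′ → ∃ λ c′ → ∃ λ a′ →
  Occ231 π b c a × Occ231 π b′ c′ a′ × b ≤ a′

-- Subsequences as increasing lists of positions

module _ {A : Set} where

  ⊆⇒positions : {xs ys : List A} → xs ⊆ ys →
    ∃ λ is → AllPairs Fin._<_ is × xs ≡ map (lookup ys) is
  ⊆⇒positions [] = [] , [] , refl
  ⊆⇒positions (y ∷ʳ s) with is , inc , refl ← ⊆⇒positions s =
    map suc is , AllPairs.map⁺ (AllPairs.map s<s inc) , map-∘ is
  ⊆⇒positions (refl ∷ s) with is , inc , refl ← ⊆⇒positions s =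
    zero ∷ map suc is ,
    All.map⁺ (All.tabulate λ _ → z<s) ∷ AllPairs.map⁺ (AllPairs.map s<s inc) ,
    cong (_ ∷_) (map-∘ is)

  positive⇒map-suc : ∀ {n} {is : List (Fin (suc n))} → All (λ i → 0 < toℕ i) is → ∃ λ js → is ≡ map suc js
  positive⇒map-suc [] = [] , refl
  positive⇒map-suc {is = suc i ∷ _} (_ ∷ ps) with js , refl ← positive⇒map-suc ps = i ∷ js , refl

  positions⇒⊆ : (ys : List A) (is : List (Fin (length ys))) → AllPairs Fin._<_ is → map (lookup ys) is ⊆ ys
  positions⇒⊆ ys [] _ = minimum ys
  positions⇒⊆ (y ∷ ys) (zero ∷ is) (0<is ∷ inc) with js , refl ← positive⇒map-suc 0<is =
    refl ∷ subst (_⊆ ys) (map-∘ js) (positions⇒⊆ ys js (AllPairs.map s<s⁻¹ (AllPairs.map⁻ inc)))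
  positions⇒⊆ (y ∷ ys) (suc i ∷ is) (i<is ∷ inc)
    with js , refl ← positive⇒map-suc (All.map (≤-<-trans z≤n) i<is) =
    y ∷ʳ subst (_⊆ ys) (cong (lookup ys i ∷_) (map-∘ js))
      (positions⇒⊆ ys (i ∷ js) (AllPairs.map s<s⁻¹ (AllPairs.map⁻ {xs = i ∷ js} (i<is ∷ inc))))

  lookup-injective : {xs : List A} → Unique xs → ∀ {i j} → lookup xs i ≡ lookup xs j → i ≡ j
  lookup-injective (_ ∷ _) {zero} {zero} _ = refl
  lookup-injective (x∉ ∷ _) {zero} {suc j} e = contradiction e (All.lookup x∉ (∈-lookup j))
  lookup-injective (x∉ ∷ _) {suc i} {zero} e = contradiction (sym e) (All.lookup x∉ (∈-lookup i))
  lookup-injective (_ ∷ u) {suc i} {suc j} e = cong suc (lookup-injective u e)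

lookup-mono-< : ∀ {vs} → AllPairs _<_ vs → ∀ {i j} → i Fin.< j → lookup vs i < lookup vs j
lookup-mono-< (v< ∷ _) {zero} {suc j} _ = All.lookup v< (∈-lookup j)
lookup-mono-< (_ ∷ inc) {suc i} {suc j} (s≤s i<j) = lookup-mono-< inc i<j

lookup-cancel-< : ∀ {vs} → AllPairs _<_ vs → ∀ {i j} → lookup vs i < lookup vs j → i Fin.< j
lookup-cancel-< inc {i} {j} p with Fin.<-cmp i j
... | tri< i<j _ _ = i<j
... | tri≈ _ refl _ = contradiction p (<-irrefl refl)
... | tri> _ _ i>j = contradiction (lookup-mono-< inc i>j) (<-asym p)

lookup-sameOrder : ∀ {vs} → AllPairs _<_ vs → (σ : List (Fin (length vs))) →
  SameOrder (map (lookup vs) σ) (map (suc ∘ toℕ) σ)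
lookup-sameOrder inc [] = _
lookup-sameOrder {vs} inc (i ∷ σ) = heads σ , lookup-sameOrder inc σ
  where
  <⇔ : ∀ i j → (lookup vs i < lookup vs j) ⇔ (suc (toℕ i) < suc (toℕ j))
  <⇔ i j = mk⇔ (s<s ∘ lookup-cancel-< inc) λ { (s≤s i<j) → lookup-mono-< inc i<j }
  heads : ∀ σ → Pointwise _ (map (lookup vs) σ) (map (suc ∘ toℕ) σ)
  heads [] = []
  heads (j ∷ σ) = (<⇔ i j , <⇔ j i) ∷ heads σ

-- `is` orders the chosen letters by place and `vs` by size; `σ` holds their ranks, counted from 0,
-- in reading order. Chains of adjacent comparisons determine both orders.
contains : ∀ {π is vs} → Linked Fin._<_ is → Linked _<_ vs → (σ : List (Fin (length vs))) →
  map (lookup π) is ≡ map (lookup vs) σ → Contains π (map (suc ∘ toℕ) σ)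
contains {π} {is} pos val σ e =
  map (lookup π) is ,
  positions⇒⊆ π is (Linked⇒AllPairs Fin.<-trans pos) ,
  subst (λ ys → SameOrder ys _) (sym e) (lookup-sameOrder (Linked⇒AllPairs <-trans val) σ)

at : ∀ {π} i → Contains π (lookup patterns i) → Any (Contains π) patterns
at i = lose (∈-lookup i)

-- From a double occurrence to one of the patterns

-- The occurrences are read at positions i < j < k and i′ < j′ < k′ of π.
module _ {π : List ℕ} (u : Unique π) where

  private
    P : Fin (length π) → ℕ
    P = lookup π

    P-distinct : ∀ {i j} → i Fin.< j → P i ≢ P j
    P-distinct i<j e with refl ← lookup-injective u e = <-irrefl refl i<j

  -- Since b stands after c′ and is smaller than b′, it completes b′ c′ to a 231. Only the rank of c
  -- relative to b′ and c′ is open, and each of its three values gives a pattern.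
  nested⇒pattern : ∀ {i j k i′ j′} →
    i′ Fin.< j′ → j′ Fin.< i → i Fin.< j → j Fin.< k →
    P k < P i → P i < P j → P i < P i′ → P i′ < P j′ → Any (Contains π) patterns
  nested⇒pattern {i} {j} {k} {i′} {j′} i′<j′ j′<i i<j j<k a<b b<c b<b′ b′<c′ with <-cmp (P j) (P i′)
  ... | tri< c<b′ _ _ = at (# 7)
          (contains (i′<j′ ∷ j′<i ∷ i<j ∷ j<k ∷ [-]) (a<b ∷ b<c ∷ c<b′ ∷ b′<c′ ∷ [-])
            (# 3 ∷ # 4 ∷ # 1 ∷ # 2 ∷ # 0 ∷ []) refl)
  ... | tri≈ _ c≡b′ _ = contradiction (sym c≡b′) (P-distinct (Fin.<-trans i′<j′ (Fin.<-trans j′<i i<j)))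
  ... | tri> _ _ c>b′ with <-cmp (P j) (P j′)
  ...   | tri< c<c′ _ _ = at (# 4)
            (contains (i′<j′ ∷ j′<i ∷ i<j ∷ j<k ∷ [-]) (a<b ∷ b<b′ ∷ c>b′ ∷ c<c′ ∷ [-])
              (# 2 ∷ # 4 ∷ # 1 ∷ # 3 ∷ # 0 ∷ []) refl)
  ...   | tri≈ _ c≡c′ _ = contradiction (sym c≡c′) (P-distinct (Fin.<-trans j′<i i<j))
  ...   | tri> _ _ c>c′ = at (# 3)
            (contains (i′<j′ ∷ j′<i ∷ i<j ∷ j<k ∷ [-]) (a<b ∷ b<b′ ∷ b′<c′ ∷ c>c′ ∷ [-])
              (# 2 ∷ # 3 ∷ # 1 ∷ # 4 ∷ # 0 ∷ []) refl)

  -- Apart from the nested case, b stands before c′. If b′ or c′ lies between b and a, it takes the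
  -- role of c and five letters suffice. Otherwise the size of c decides: between a′ and c′ it
  -- replaces b′; above c′ it replaces c′ when b′ comes before b; in the other cases all six letters
  -- are used.
  doubleOcc⇒pattern : DoubleOcc π → Any (Contains π) patterns
  doubleOcc⇒pattern (_ , _ , _ , _ , _ , _ , occ a<b b<c s , occ a′<b′ b′<c′ s′ , b≤a′)
    with (i ∷ j ∷ k ∷ []) , ((i<j ∷ _) ∷ (j<k ∷ []) ∷ [] ∷ []) , refl ← ⊆⇒positions s
       | (i′ ∷ j′ ∷ k′ ∷ []) , ((i′<j′ ∷ _) ∷ (j′<k′ ∷ []) ∷ [] ∷ []) , refl ← ⊆⇒positions s′
    with Fin.<-cmp i j′
  ... | tri> _ _ j′<i = nested⇒pattern i′<j′ j′<i i<j j<k a<b b<c (≤-<-trans b≤a′ a′<b′) b′<c′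
  ... | tri≈ _ refl _ = contradiction (<-trans a′<b′ b′<c′) (≤⇒≯ b≤a′)
  ... | tri< i<j′ _ _ = case-i
    where
    b<a′ : P i < P k′
    -- Equality would force `i` and `k′` to coincide, but `j′` lies between them. A shared letter b
    -- = a′ can thus occur only in the nested case.
    b<a′ = ≤∧≢⇒< b≤a′ (P-distinct (Fin.<-trans i<j′ j′<k′))
    case-i : Any (Contains π) patterns
    case-i with Fin.<-cmp i i′
    ... | tri≈ _ refl _ = contradiction a′<b′ (≤⇒≯ b≤a′)
    ... | tri< i<i′ _ _ with Fin.<-cmp k i′
    ...   | tri≈ _ refl _ = contradiction (<-trans b<a′ a′<b′) (<-asym a<b)
    ...   | tri> _ _ i′<k with Fin.<-cmp k j′
    ...     | tri≈ _ refl _ = contradiction (<-trans b<a′ (<-trans a′<b′ b′<c′)) (<-asym a<b)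
    ...     | tri< k<j′ _ _ = at (# 0)
                (contains (i<i′ ∷ i′<k ∷ k<j′ ∷ j′<k′ ∷ [-]) (a<b ∷ b<a′ ∷ a′<b′ ∷ b′<c′ ∷ [-])
                  (# 1 ∷ # 3 ∷ # 0 ∷ # 4 ∷ # 2 ∷ []) refl)
    ...     | tri> _ _ j′<k with Fin.<-cmp k k′
    ...       | tri≈ _ refl _ = contradiction b<a′ (<-asym a<b)
    ...       | tri< k<k′ _ _ = at (# 1)
                  (contains (i<i′ ∷ i′<j′ ∷ j′<k ∷ k<k′ ∷ [-]) (a<b ∷ b<a′ ∷ a′<b′ ∷ b′<c′ ∷ [-])
                    (# 1 ∷ # 3 ∷ # 4 ∷ # 0 ∷ # 2 ∷ []) refl)
    ...       | tri> _ _ k′<k = at (# 2)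
                  (contains (i<i′ ∷ i′<j′ ∷ j′<k′ ∷ k′<k ∷ [-]) (a<b ∷ b<a′ ∷ a′<b′ ∷ b′<c′ ∷ [-])
                    (# 1 ∷ # 3 ∷ # 4 ∷ # 2 ∷ # 0 ∷ []) refl)
    case-i | tri< i<i′ _ _ | tri< k<i′ _ _ with <-cmp (P j) (P k′)
    ...     | tri≈ _ c≡a′ _ = contradiction c≡a′ (P-distinct (Fin.<-trans j<k (Fin.<-trans k<i′ (Fin.<-trans i′<j′ j′<k′))))
    ...     | tri< c<a′ _ _ = at (# 9)
                (contains (i<j ∷ j<k ∷ k<i′ ∷ i′<j′ ∷ j′<k′ ∷ [-]) (a<b ∷ b<c ∷ c<a′ ∷ a′<b′ ∷ b′<c′ ∷ [-])
                  (# 1 ∷ # 2 ∷ # 0 ∷ # 4 ∷ # 5 ∷ # 3 ∷ []) refl)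
    ...     | tri> _ _ c>a′ with <-cmp (P j) (P j′)
    ...       | tri≈ _ c≡c′ _ = contradiction c≡c′ (P-distinct (Fin.<-trans j<k (Fin.<-trans k<i′ i′<j′)))
    ...       | tri< c<c′ _ _ = at (# 0)
                  (contains (i<j ∷ j<k ∷ Fin.<-trans k<i′ i′<j′ ∷ j′<k′ ∷ [-]) (a<b ∷ b<a′ ∷ c>a′ ∷ c<c′ ∷ [-])
                    (# 1 ∷ # 3 ∷ # 0 ∷ # 4 ∷ # 2 ∷ []) refl)
    ...       | tri> _ _ c>c′ = at (# 8)
                (contains (i<j ∷ j<k ∷ k<i′ ∷ i′<j′ ∷ j′<k′ ∷ [-]) (a<b ∷ b<a′ ∷ a′<b′ ∷ b′<c′ ∷ c>c′ ∷ [-])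
                  (# 1 ∷ # 5 ∷ # 0 ∷ # 3 ∷ # 4 ∷ # 2 ∷ []) refl)
    case-i | tri> _ _ i′<i with Fin.<-cmp k j′
    ...   | tri≈ _ refl _ = contradiction (<-trans b<a′ (<-trans a′<b′ b′<c′)) (<-asym a<b)
    ...   | tri> _ _ j′<k with Fin.<-cmp k k′
    ...     | tri≈ _ refl _ = contradiction b<a′ (<-asym a<b)
    ...     | tri< k<k′ _ _ = at (# 5)
                (contains (i′<i ∷ i<j′ ∷ j′<k ∷ k<k′ ∷ [-]) (a<b ∷ b<a′ ∷ a′<b′ ∷ b′<c′ ∷ [-])
                  (# 3 ∷ # 1 ∷ # 4 ∷ # 0 ∷ # 2 ∷ []) refl)
    ...     | tri> _ _ k′<k = at (# 6)
                (contains (i′<i ∷ i<j′ ∷ j′<k′ ∷ k′<k ∷ [-]) (a<b ∷ b<a′ ∷ a′<b′ ∷ b′<c′ ∷ [-])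
                  (# 3 ∷ # 1 ∷ # 4 ∷ # 2 ∷ # 0 ∷ []) refl)
    case-i | tri> _ _ i′<i | tri< k<j′ _ _ with <-cmp (P j) (P k′)
    ...     | tri≈ _ c≡a′ _ = contradiction c≡a′ (P-distinct (Fin.<-trans j<k (Fin.<-trans k<j′ j′<k′)))
    ...     | tri< c<a′ _ _ = at (# 10)
                (contains (i′<i ∷ i<j ∷ j<k ∷ k<j′ ∷ j′<k′ ∷ [-]) (a<b ∷ b<c ∷ c<a′ ∷ a′<b′ ∷ b′<c′ ∷ [-])
                  (# 4 ∷ # 1 ∷ # 2 ∷ # 0 ∷ # 5 ∷ # 3 ∷ []) refl)
    ...     | tri> _ _ c>a′ with <-cmp (P j) (P j′)
    ...       | tri≈ _ c≡c′ _ = contradiction c≡c′ (P-distinct (Fin.<-trans j<k k<j′))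
    ...       | tri< c<c′ _ _ = at (# 0)
                  (contains (i<j ∷ j<k ∷ k<j′ ∷ j′<k′ ∷ [-]) (a<b ∷ b<a′ ∷ c>a′ ∷ c<c′ ∷ [-])
                    (# 1 ∷ # 3 ∷ # 0 ∷ # 4 ∷ # 2 ∷ []) refl)
    ...       | tri> _ _ c>c′ = at (# 5)
                  (contains (i′<i ∷ i<j ∷ j<k ∷ Fin.<-trans k<j′ j′<k′ ∷ [-]) (a<b ∷ b<a′ ∷ a′<b′ ∷ <-trans b′<c′ c>c′ ∷ [-])
                    (# 3 ∷ # 1 ∷ # 4 ∷ # 0 ∷ # 2 ∷ []) refl)

-- Every pattern carries a double occurrence

OrderIso : ℕ × ℕ → ℕ × ℕ → Set
OrderIso (x , y) (x′ , y′) = ((x < x′) ⇔ (y < y′)) × ((x′ < x) ⇔ (y′ < y))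

sameOrder⇒orderIso : ∀ ys σ → SameOrder ys σ → AllPairs OrderIso (zip ys σ)
sameOrder⇒orderIso [] [] _ = []
sameOrder⇒orderIso (y ∷ ys) (x ∷ σ) (hs , so) = heads hs ∷ sameOrder⇒orderIso ys σ so
  where
  heads : ∀ {ys σ} → Pointwise (λ y′ x′ → OrderIso (y , x) (y′ , x′)) ys σ → All (OrderIso (y , x)) (zip ys σ)
  heads [] = []
  heads (h ∷ hs) = h ∷ heads hs

-- Letters of two different occurrences get compared, so they may come in either order of position
-- or coincide; `AllPairs` alone covers only one order.
orderIso-∈ : ∀ {zs} → AllPairs OrderIso zs → ∀ {p q} → p ∈ zs → q ∈ zs → OrderIso p q
orderIso-∈ (_ ∷ _) (here refl) (here refl) =
  mk⇔ (⊥-elim ∘ <-irrefl refl) (⊥-elim ∘ <-irrefl refl) ,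
  mk⇔ (⊥-elim ∘ <-irrefl refl) (⊥-elim ∘ <-irrefl refl)
orderIso-∈ (h ∷ _) (here refl) (there q∈) = All.lookup h q∈
orderIso-∈ (h ∷ _) (there p∈) (here refl) = let a , b = All.lookup h p∈ in b , a
orderIso-∈ (_ ∷ iso) (there p∈) (there q∈) = orderIso-∈ iso p∈ q∈

lift-⊆ : ∀ ys σ → SameOrder ys σ → ∀ {τ} → τ ⊆ σ →
  ∃ λ ρ → ρ ⊆ ys × Pointwise (λ y x → (y , x) ∈ zip ys σ) ρ τ
lift-⊆ [] [] _ [] = [] , [] , []
lift-⊆ (y ∷ ys) (x ∷ σ) (_ , so) (.x ∷ʳ s) with ρ , s′ , zs ← lift-⊆ ys σ so s =
  ρ , y ∷ʳ s′ , Pointwise.map there zs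
lift-⊆ (y ∷ ys) (x ∷ σ) (_ , so) (refl ∷ s) with ρ , s′ , zs ← lift-⊆ ys σ so s =
  y ∷ ρ , refl ∷ s′ , here refl ∷ Pointwise.map there zs

doubleOcc-contains : ∀ {π σ} → Contains π σ → DoubleOcc σ → DoubleOcc π
doubleOcc-contains {π} {σ} (ys , ys⊆π , so) (_ , _ , _ , _ , _ , _ , occ p q s , occ p′ q′ s′ , r)
  with (b ∷ c ∷ a ∷ []) , t , (b∈ ∷ c∈ ∷ a∈ ∷ []) ← lift-⊆ ys σ so s
     | (b′ ∷ c′ ∷ a′ ∷ []) , t′ , (b′∈ ∷ c′∈ ∷ a′∈ ∷ []) ← lift-⊆ ys σ so s′ =
  b , c , a , b′ , c′ , a′ ,
  occ (below a∈ b∈ p) (below b∈ c∈ q) (⊆-trans t ys⊆π) ,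
  occ (below a′∈ b′∈ p′) (below b′∈ c′∈ q′) (⊆-trans t′ ys⊆π) ,
  -- Order isomorphism transports strict inequalities only, so the weak one is obtained by refuting
  -- `a′ < b`.
  ≮⇒≥ λ a′<b → contradiction r (<⇒≱ (Equivalence.to (proj₁ (iso a′∈ b∈)) a′<b))
  where
  iso : ∀ {p q} → p ∈ zip ys σ → q ∈ zip ys σ → OrderIso p q
  iso = orderIso-∈ (sameOrder⇒orderIso ys σ so)
  below : ∀ {y x y′ x′} → (y , x) ∈ zip ys σ → (y′ , x′) ∈ zip ys σ → x < x′ → y < y′
  below p∈ q∈ = Equivalence.from (proj₁ (iso p∈ q∈))

-- Each row gives the lower occurrence and then the upper one, and evaluation checks them. In the
-- fourth and fifth rows the letter 2 is both b and a′.
patterns-doubleOcc : All DoubleOcc patterns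
patterns-doubleOcc =
    two 2 4 1 4 5 3
  ∷ two 2 4 1 4 5 3
  ∷ two 2 4 1 4 5 3
  ∷ two 2 5 1 3 4 2
  ∷ two 2 4 1 3 5 2
  ∷ two 2 5 1 4 5 3
  ∷ two 2 5 1 4 5 3
  ∷ two 2 3 1 4 5 3
  ∷ two 2 6 1 4 5 3
  ∷ two 2 3 1 5 6 4
  ∷ two 2 3 1 5 6 4
  ∷ []
  where
  two : ∀ {σ} b c a b′ c′ a′ →
    {True (a <? b ×-dec b <? c ×-dec (b ∷ c ∷ a ∷ []) ⊆? σ ×-dec
           a′ <? b′ ×-dec b′ <? c′ ×-dec (b′ ∷ c′ ∷ a′ ∷ []) ⊆? σ ×-dec b ≤? a′)} → DoubleOcc σ
  two b c a b′ c′ a′ {t} with p , q , s , p′ , q′ , s′ , r ← toWitness t =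
    b , c , a , b′ , c′ , a′ , occ p q s , occ p′ q′ s′ , r

-- Separated values and sublist tools

Separated : List ℕ → ℕ → Set
Separated π k = ∃ λ c → Occ231 π (suc k) c k

module _ {A : Set} where

  ⊆-++∷⁻ : ∀ (xs : List A) {c zs ys} → xs ++ c ∷ zs ⊆ ys →
    ∃ λ pre → ∃ λ post → ys ≡ pre ++ c ∷ post × xs ⊆ pre × zs ⊆ post
  ⊆-++∷⁻ [] (y ∷ʳ s) with pre , post , refl , _ , t ← ⊆-++∷⁻ [] s =
    y ∷ pre , post , refl , minimum _ , t
  ⊆-++∷⁻ [] (refl ∷ s) = [] , _ , refl , [] , s
  ⊆-++∷⁻ (x ∷ xs) (y ∷ʳ s) with pre , post , refl , t , t′ ← ⊆-++∷⁻ (x ∷ xs) s =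
    y ∷ pre , post , refl , y ∷ʳ t , t′
  ⊆-++∷⁻ (x ∷ xs) (refl ∷ s) with pre , post , refl , t , t′ ← ⊆-++∷⁻ xs s =
    x ∷ pre , post , refl , refl ∷ t , t′

  unique-⊆ : ∀ {xs ys : List A} → xs ⊆ ys → Unique ys → Unique xs
  unique-⊆ [] _ = []
  unique-⊆ (_ ∷ʳ s) (_ ∷ u) = unique-⊆ s u
  unique-⊆ (refl ∷ s) (x∉ ∷ u) = All-resp-⊆ s x∉ ∷ unique-⊆ s u

  unique-++-disjoint : ∀ (xs : List A) {ys x} → Unique (xs ++ ys) → x ∈ xs → x ∉ ys
  unique-++-disjoint (x ∷ xs) (x∉ ∷ _) (here refl) x∈ys = All.lookup x∉ (∈-++⁺ʳ xs x∈ys) refl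
  unique-++-disjoint (x ∷ xs) (_ ∷ u) (there x∈xs) = unique-++-disjoint xs u x∈xs

  -- As `k` occurs only once, the last letter of the sublist must be the displayed `k`, which leaves
  -- `l` for all earlier ones.
  ⊆-before : ∀ (l : List A) {zs k r} → Unique (l ++ k ∷ r) → zs ++ k ∷ [] ⊆ l ++ k ∷ r → zs ⊆ l
  ⊆-before l {[]} _ _ = minimum l
  ⊆-before [] {z ∷ zs} (k∉ ∷ _) (_ ∷ʳ s) =
    contradiction refl (All.lookup k∉ (Sublist.lookup s (∈-++⁺ʳ (z ∷ zs) (here refl))))
  ⊆-before [] {z ∷ zs} (k∉ ∷ _) (refl ∷ s) =
    contradiction refl (All.lookup k∉ (Sublist.lookup s (∈-++⁺ʳ zs (here refl))))
  ⊆-before (x ∷ l) {z ∷ zs} (_ ∷ u) (_ ∷ʳ s) = x ∷ʳ ⊆-before l u s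
  ⊆-before (x ∷ l) {z ∷ zs} (_ ∷ u) (refl ∷ s) = refl ∷ ⊆-before l u s

  filter-filter : ∀ {P Q : A → Set} (P? : ∀ x → Dec (P x)) (Q? : ∀ x → Dec (Q x)) →
    (∀ {x} → Q x → P x) → ∀ xs → filter Q? (filter P? xs) ≡ filter Q? xs
  filter-filter P? Q? Q⇒P [] = refl
  filter-filter P? Q? Q⇒P (x ∷ xs) with P? x
  ... | no ¬p = trans (filter-filter P? Q? Q⇒P xs) (sym (filter-reject Q? (¬p ∘ Q⇒P)))
  ... | yes p with Q? x
  ...   | yes q = cong (x ∷_) (filter-filter P? Q? Q⇒P xs)
  ...   | no ¬q = filter-filter P? Q? Q⇒P xs

oneTo-suc : ∀ n → oneTo n ++ suc n ∷ [] ≡ oneTo (suc n)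
oneTo-suc n = trans (sym (map-++ suc (upTo n) (n ∷ []))) (cong (map suc) (upTo-∷ʳ n))

oneTo-injective : ∀ {m n} → oneTo m ≡ oneTo n → m ≡ n
oneTo-injective {m} {n} e = trans (sym (length-oneTo m)) (trans (cong length e) (length-oneTo n))
  where
  length-oneTo : ∀ n → length (oneTo n) ≡ n
  length-oneTo n = trans (length-map suc (upTo n)) (length-upTo n)

-- Separated values against double occurrences

module _ {π : List ℕ} (perm : IsPerm π) where

  private
    N : ℕ
    N = length π

  perm-unique : Unique π
  perm-unique = Permutationₛ.Unique-resp-↭ (setoid ℕ) (↭⇒↭ₛ (↭-sym perm))
    (Unique.map⁺ suc-injective (Unique.upTo⁺ N))

  ∈-perm⁻ : ∀ {x} → x ∈ π → 0 < x × x ≤ N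
  ∈-perm⁻ x∈π with y , y∈ , refl ← ∈-map⁻ suc (∈-resp-↭ perm x∈π) = z<s , ∈-upTo⁻ y∈

  ∈-perm⁺ : ∀ {x} → 0 < x → x ≤ N → x ∈ π
  ∈-perm⁺ {suc x} _ x<N = ∈-resp-↭ (↭-sym perm) (∈-map⁺ suc (∈-upTo⁺ x<N))

  -- Descending from b to a through the values of π, some step k+1 → k crosses the position of c.
  occ⇒separated : ∀ {b c a} → Occ231 π b c a → ∃ λ k → a ≤ k × k < b × Separated π k
  occ⇒separated {b} {c} {a} (occ a<b b<c s)
    with pre , post , refl , b⊆ , a⊆ ← ⊆-++∷⁻ (b ∷ []) s =
    cross b a<b b<c (to∈ b⊆) ≤-refl
    where
    a∈ : a ∈ post
    a∈ = to∈ a⊆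
    cross : ∀ d → a < d → d < c → d ∈ pre → d ≤ b →
      ∃ λ k → a ≤ k × k < b × Separated (pre ++ c ∷ post) k
    cross (suc d) (s≤s a≤d) d<c d∈ d≤b
      -- `d` is a value of π because it lies between a, which is positive, and the value `suc d` of
      -- π.
      with ∈-++⁻ pre (∈-perm⁺ {d} (≤-trans (proj₁ (∈-perm⁻ (∈-++⁺ʳ pre (there a∈)))) a≤d)
                               (≤-trans (n≤1+n d) (proj₂ (∈-perm⁻ (∈-++⁺ˡ d∈)))))
    ... | inj₂ (here refl) = contradiction d<c (<-asym (n<1+n d))
    ... | inj₂ (there d∈post) =
      d , a≤d , d≤b , c , occ (n<1+n d) d<c (++⁺ (from∈ d∈) (refl ∷ from∈ d∈post))
    ... | inj₁ d∈pre with m≤n⇒m<n∨m≡n a≤d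
    ...   | inj₁ a<d = cross d a<d (<-trans (n<1+n d) d<c) d∈pre (≤-trans (n≤1+n d) d≤b)
    ...   | inj₂ refl = contradiction (there a∈) (unique-++-disjoint pre perm-unique d∈pre)

  -- The descents from b to a and from b′ to a′ do not overlap: k < b ≤ a′ ≤ l.
  doubleOcc⇒separated : DoubleOcc π → ∃ λ k → ∃ λ l → k < l × Separated π k × Separated π l
  doubleOcc⇒separated (_ , _ , _ , _ , _ , _ , o , o′ , b≤a′)
    with k , _ , k<b , sk ← occ⇒separated o | l , a′≤l , _ , sl ← occ⇒separated o′ =
    k , l , ≤-trans k<b (≤-trans b≤a′ a′≤l) , sk , sl

  -- With b = k + 1 and a′ = l, the condition `b ≤ a′` is `k < l` by definition.
  separated⇒doubleOcc : ∀ {k l} → k < l → Separated π k → Separated π l → DoubleOcc π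
  separated⇒doubleOcc k<l (_ , o) (_ , o′) = _ , _ , _ , _ , _ , _ , o , o′ , k<l

  -- Invariant and outcome of a single pass

  remaining : ℕ → List ℕ
  remaining n = filter (suc n ≤?_) π

  remaining-unique : ∀ n → Unique (remaining n)
  remaining-unique n = unique-⊆ (filter-⊆ (suc n ≤?_) π) perm-unique

  remaining-output : ∀ n l {r} → remaining n ≡ l ++ suc n ∷ r → remaining (suc n) ≡ l ++ r
  remaining-output n l {r} e = begin
    remaining (suc n)                                    ≡⟨ filter-filter (suc n ≤?_) (2+n ≤?_) <⇒≤ π ⟨
    filter (2+n ≤?_) (remaining n)                       ≡⟨ cong (filter (2+n ≤?_)) e ⟩
    filter (2+n ≤?_) (l ++ suc n ∷ r)                    ≡⟨ filter-++ (2+n ≤?_) l _ ⟩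
    filter (2+n ≤?_) l ++ filter (2+n ≤?_) (suc n ∷ r)   ≡⟨ cong₂ _++_ (filter-all (2+n ≤?_) l>)
                                                            (trans (filter-reject (2+n ≤?_) (<-irrefl refl))
                                                                   (filter-all (2+n ≤?_) r>)) ⟩
    l ++ r                                               ∎
    where
    open ≡-Reasoning
    2+n : ℕ
    2+n = suc (suc n)
    u : Unique (l ++ suc n ∷ r)
    u = subst Unique e (remaining-unique n)
    ≥ : ∀ {x} → x ∈ l ++ suc n ∷ r → suc n ≤ x
    ≥ x∈ = proj₂ (∈-filter⁻ (suc n ≤?_) {xs = π} (subst (_ ∈_) (sym e) x∈))
    l> : All (2+n ≤_) l
    l> = All.tabulate λ x∈ → ≤∧≢⇒< (≥ (∈-++⁺ˡ x∈)) λ { refl → unique-++-disjoint l u x∈ (here refl) }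
    r> : All (2+n ≤_) r
    r> = All.tabulate λ x∈ → ≤∧≢⇒< (≥ (∈-++⁺ʳ l (there x∈)))
      λ { refl → unique-++-disjoint (l ++ suc n ∷ []) (subst Unique (sym (++-assoc l (suc n ∷ []) r)) u)
                   (∈-++⁺ʳ l (here refl)) x∈ }

  -- Put k = n + 1. The letters of the word k + 1, c, k all exceed n, so the word survives in
  -- `remaining n`. What precedes k there is on the stack, and reversal puts c above k + 1.
  separated⇒buried : ∀ {n s xs} → remaining n ≡ reverse s ++ suc n ∷ xs → Separated π (suc n) →
    ∃ λ c → c ∷ suc (suc n) ∷ [] ⊆ s
  separated⇒buried {n} {s} e (c , occ n<1+n 1+n<c t) = c , reverse⁻
    (⊆-before (reverse s) (subst Unique e (remaining-unique n))
      (subst₂ _⊆_ (filter-all (suc n ≤?_) (<⇒≤ n<1+n ∷ <⇒≤ (<-trans n<1+n 1+n<c) ∷ ≤-refl ∷ [])) e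
        (filter⁺ (suc n ≤?_) (suc n ≤?_) (λ { refl p → p }) t)))

  -- The lower bound is strict because m may itself be separated, having ended the previous pass.
  NoneSeparated : ℕ → ℕ → Set
  NoneSeparated m n = ∀ j → m < j → j < n → ¬ Separated π j

  extendNone : ∀ {m n} → NoneSeparated m n → ¬ Separated π n → NoneSeparated m (suc n)
  extendNone none ¬sep j m<j (s≤s j≤n) sep with m≤n⇒m<n∨m≡n j≤n
  ... | inj₁ j<n = none j m<j j<n sep
  ... | inj₂ refl = ¬sep sep

  -- The pass began when m was the last output, and now n is; s is the stack.
  data Status (m n : ℕ) (s : List ℕ) : Set where
    free    : suc n ∉ s → NoneSeparated m (suc n) → Status m n s
    blocked : m < n → Separated π n → NoneSeparated m n → suc n ∈ s → Status m n s

  -- Pushing keeps the order of the entries, so the stack read from the bottom, followed by the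
  -- unread input, always spells `remaining n`.
  data Reached (m : ℕ) (xs : List ℕ) : State → Set where
    reached : ∀ n s → m ≤ n → n ≤ N → remaining n ≡ reverse s ++ xs → Status m n s →
      Reached m xs (st (suc n) s (oneTo n))

  reverse-∷-++ : ∀ (x : ℕ) s {xs} → reverse (x ∷ s) ++ xs ≡ reverse s ++ x ∷ xs
  reverse-∷-++ x s {xs} = trans (cong (_++ xs) (unfold-reverse x s)) (++-assoc (reverse s) (x ∷ []) xs)

  next≤N : ∀ {n} l {r} → remaining n ≡ l ++ suc n ∷ r → suc n ≤ N
  next≤N {n} l e = proj₂ (∈-perm⁻ (proj₁ (∈-filter⁻ (suc n ≤?_) {xs = π} (subst (suc n ∈_) (sym e) (∈-insert l)))))

  -- Here k + 1 has just been output. If k + 2 is on top of the stack, it follows and k + 1 is not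
  -- separated; if it lies deeper, k + 1 is separated and the pass is blocked; if it is not on the
  -- stack, k + 1 is not separated. The hypothesis uses `remaining k`, in which k + 1 still marks
  -- the border between stack and input.
  popAll-reached : ∀ {m xs} k s → m ≤ k → remaining k ≡ reverse s ++ suc k ∷ xs →
    NoneSeparated m (suc k) → Reached m xs (popAll (suc (suc k)) s (oneTo (suc k)))
  popAll-reached k [] m≤k e none =
    reached (suc k) [] (m≤n⇒m≤1+n m≤k) (next≤N [] e) (remaining-output k [] e)
      (free (λ ()) (extendNone none λ sep → case separated⇒buried {s = []} e sep of λ { (_ , ()) }))
  popAll-reached {m} {xs} k (y ∷ t) m≤k e none with y ≟ suc (suc k)
  ... | yes refl = subst (λ out → Reached m xs (popAll (suc (suc (suc k))) t out)) (sym (oneTo-suc (suc k)))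
    (popAll-reached (suc k) t (m≤n⇒m≤1+n m≤k) e′ (extendNone none ¬sep))
    where
    e′ : remaining (suc k) ≡ reverse t ++ suc (suc k) ∷ xs
    e′ = trans (remaining-output k (reverse (y ∷ t)) e) (reverse-∷-++ y t)
    ¬sep : ¬ Separated π (suc k)
    -- Separation would put some c above k + 2, which is the top; then k + 2 would occur a second
    -- time, in `t`.
    ¬sep sep with separated⇒buried e sep
    ... | c , buried = unique-++-disjoint (reverse t) (subst Unique e′ (remaining-unique (suc k)))
      (Any.reverse⁺ (∈t buried)) (here refl)
      where
      ∈t : ∀ {c} → c ∷ y ∷ [] ⊆ y ∷ t → y ∈ t
      ∈t (_ ∷ʳ s) = Sublist.lookup s (there (here refl))
      ∈t (refl ∷ s) = to∈ s
  ... | no y≢ =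
    reached (suc k) (y ∷ t) (m≤n⇒m≤1+n m≤k) (next≤N (reverse (y ∷ t)) e) (remaining-output k (reverse (y ∷ t)) e) status
    where
    u : Unique (reverse (y ∷ t) ++ suc k ∷ xs)
    u = subst Unique e (remaining-unique k)
    k<y : suc k ≤ y
    k<y = proj₂ (∈-filter⁻ (suc k ≤?_) {xs = π}
      (subst (y ∈_) (sym e) (∈-++⁺ˡ (Any.reverse⁺ {xs = y ∷ t} (here refl)))))
    y≢1+k : suc k ≢ y
    y≢1+k refl = unique-++-disjoint (reverse (y ∷ t)) u (Any.reverse⁺ {xs = y ∷ t} (here refl)) (here refl)
    status : Status m (suc k) (y ∷ t)
    status with suc (suc k) ∈? t
    ... | yes ∈t = blocked (s≤s m≤k)
      -- The top `y` is the required c: it lies above k + 2 on the stack, hence after k + 2 and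
      -- before k + 1 in π.
      (y , occ (n<1+n _) (≤∧≢⇒< (≤∧≢⇒< k<y y≢1+k) (y≢ ∘ sym))
        (⊆-trans (++⁺ (reverse⁺ {as = y ∷ suc (suc k) ∷ []} (refl ∷ from∈ ∈t)) (refl ∷ minimum xs))
          (subst (_⊆ π) e (filter-⊆ (suc k ≤?_) π))))
      none (there ∈t)
    ... | no ∉t = free ∉y∷t
      (extendNone none λ sep → ∉y∷t (Sublist.lookup (proj₂ (separated⇒buried e sep)) (there (here refl))))
      where
      ∉y∷t : suc (suc k) ∉ y ∷ t
      ∉y∷t (here y≡) = y≢ (sym y≡)
      ∉y∷t (there ∈t) = ∉t ∈t

  step-reached : ∀ {m n xs} x s → m ≤ n → n ≤ N → remaining n ≡ reverse s ++ x ∷ xs → Status m n s →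
    Reached m xs (popAll (suc n) (x ∷ s) (oneTo n))
  step-reached {m} {n} {xs} x s m≤n n≤N e status with x ≟ suc n
  ... | no x≢ = reached n (x ∷ s) m≤n n≤N (trans e (sym (reverse-∷-++ x s))) (push status)
    where
    push : Status m n s → Status m n (x ∷ s)
    push (free n∉ none) = free (λ { (here n≡x) → x≢ (sym n≡x) ; (there n∈) → n∉ n∈ }) none
    push (blocked m<n sep none n∈) = blocked m<n sep none (there n∈)
  step-reached {n = n} x s m≤n n≤N e (free _ none) | yes refl =
    subst (λ out → Reached _ _ (popAll (suc (suc n)) s out)) (sym (oneTo-suc n)) (popAll-reached _ s m≤n e none)
  -- A blocked n + 1 is already on the stack, so it cannot be read again.
  step-reached {n = n} x s m≤n n≤N e (blocked _ _ _ n∈) | yes refl =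
    contradiction (here refl)
      (unique-++-disjoint (reverse s) (subst Unique e (remaining-unique n)) (Any.reverse⁺ n∈))

  pushAll-reached : ∀ {m σ} xs → Reached m xs σ → Reached m [] (pushAll σ xs)
  pushAll-reached [] r = r
  pushAll-reached (x ∷ xs) (reached n s m≤n n≤N e status) =
    pushAll-reached xs (step-reached x s m≤n n≤N e status)

  data PassEnd (m : ℕ) : Config → Set where
    finished : NoneSeparated m (suc N) → PassEnd m (cfg (suc N) (remaining N) (oneTo N))
    stopped  : ∀ n → m < n → n ≤ N → Separated π n → NoneSeparated m n →
      PassEnd m (cfg (suc n) (remaining n) (oneTo n))

  pass-end : ∀ {m} inp → m ≤ N → remaining m ≡ inp → PassEnd m (pass (cfg (suc m) inp (oneTo m)))
  pass-end {m} inp m≤N e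
    with pushAll (st (suc m) [] (oneTo m)) inp
       | pushAll-reached inp (reached m [] ≤-refl m≤N e
           (free (λ ()) λ j m<j j<1+m → contradiction m<j (≤⇒≯ (s≤s⁻¹ j<1+m))))
  ... | _ | reached n s m≤n n≤N e′ status
    -- With the input exhausted, the entries returned are exactly `remaining n`.
    rewrite trans (sym (++-identityʳ (reverse s))) (sym e′) with status
  ...   | blocked m<n sep none _ = stopped n m<n n≤N sep none
  ...   | free n∉ none with m≤n⇒m<n∨m≡n n≤N
  ...     | inj₂ refl = finished none
  -- With n < N, the value n + 1 is still to be output and everything has been read, so it is on the
  -- stack, against `free`.
  ...     | inj₁ n<N = contradiction n∈s n∉
    where
    n∈s : suc n ∈ s
    n∈s = Any.reverse⁻ (subst (suc n ∈_) (trans e′ (++-identityʳ _))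
      (∈-filter⁺ (suc n ≤?_) (∈-perm⁺ z<s n<N) ≤-refl))

  -- Sortability by two passes

  first-pass : PassEnd 0 (run 1 π)
  first-pass = pass-end π z≤n (filter-all (1 ≤?_) (All.tabulate (proj₁ ∘ ∈-perm⁻)))

  second-pass : ∀ {n} → n ≤ N → PassEnd n (pass (cfg (suc n) (remaining n) (oneTo n)))
  second-pass n≤N = pass-end _ n≤N refl

  -- If both passes stopped early, they would stop at separated values k < l, which form a double
  -- occurrence.
  noDoubleOcc⇒sortable : ¬ DoubleOcc π → Sortable 2 π
  noDoubleOcc⇒sortable ¬double = after-first (run 1 π) first-pass
    where
    after-second : ∀ {n c} → PassEnd n c → (∀ l → n < l → l ≤ N → ¬ Separated π l) → output c ≡ oneTo N
    after-second (finished _) _ = refl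
    after-second (stopped l n<l l≤N sep _) none = contradiction sep (none l n<l l≤N)
    after-first : ∀ c → PassEnd 0 c → output (pass c) ≡ oneTo N
    after-first _ (finished _) =
      after-second (second-pass ≤-refl) λ l N<l l≤N _ → <⇒≱ N<l l≤N
    after-first _ (stopped k _ k≤N sep-k _) =
      after-second (second-pass k≤N) λ l k<l _ sep-l → ¬double (separated⇒doubleOcc k<l sep-k sep-l)

  separated-bounds : ∀ {k} → Separated π k → 0 < k × k < N
  separated-bounds (_ , occ _ _ s) =
    proj₁ (∈-perm⁻ (Sublist.lookup s (there (there (here refl))))) , proj₂ (∈-perm⁻ (Sublist.lookup s (here refl)))

  -- The first pass cannot get beyond the separated value k, so the second starts below l and cannot
  -- get beyond l.
  sortable⇒noDoubleOcc : Sortable 2 π → ¬ DoubleOcc π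
  sortable⇒noDoubleOcc sorted double
    with k , l , k<l , sep-k , sep-l ← doubleOcc⇒separated double
    with 0<k , k<N ← separated-bounds sep-k | _ , l<N ← separated-bounds sep-l
    = after-first (run 1 π) first-pass sorted
    where
    after-second : ∀ {n c} → n < l → PassEnd n c → output c ≢ oneTo N
    after-second n<l (finished none) _ = none l n<l (m<n⇒m<1+n l<N) sep-l
    -- Stopping with the full output would mean i = N, and l < N would then have been passed as
    -- well.
    after-second n<l (stopped i _ _ _ none) e with refl ← oneTo-injective {i} {N} e = none l n<l l<N sep-l
    after-first : ∀ c → PassEnd 0 c → output (pass c) ≢ oneTo N
    after-first _ (finished none) _ = none k 0<k (m<n⇒m<1+n k<N) sep-k
    after-first _ (stopped i _ i≤N _ none) =
      after-second (≤-<-trans (≮⇒≥ λ k<i → none k 0<k k<i sep-k) k<l) (second-pass i≤N)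

theorem2p8 : (π : List ℕ) → IsPerm π →
    Sortable 2 π ⇔
    All (Avoids π)
    ( (2 ∷ 4 ∷ 1 ∷ 5 ∷ 3 ∷ [])
    ∷ (2 ∷ 4 ∷ 5 ∷ 1 ∷ 3 ∷ [])
    ∷ (2 ∷ 4 ∷ 5 ∷ 3 ∷ 1 ∷ [])
    ∷ (3 ∷ 4 ∷ 2 ∷ 5 ∷ 1 ∷ [])
    ∷ (3 ∷ 5 ∷ 2 ∷ 4 ∷ 1 ∷ [])
    ∷ (4 ∷ 2 ∷ 5 ∷ 1 ∷ 3 ∷ [])
    ∷ (4 ∷ 2 ∷ 5 ∷ 3 ∷ 1 ∷ [])
    ∷ (4 ∷ 5 ∷ 2 ∷ 3 ∷ 1 ∷ [])
    ∷ (2 ∷ 6 ∷ 1 ∷ 4 ∷ 5 ∷ 3 ∷ [])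
    ∷ (2 ∷ 3 ∷ 1 ∷ 5 ∷ 6 ∷ 4 ∷ [])
    ∷ (5 ∷ 2 ∷ 3 ∷ 1 ∷ 6 ∷ 4 ∷ [])
    ∷ [])
theorem2p8 π perm = mk⇔
  (λ sorted → All.map (λ double con → sortable⇒noDoubleOcc perm sorted (doubleOcc-contains con double)) patterns-doubleOcc)
  (λ avoids → noDoubleOcc⇒sortable perm (All.All¬⇒¬Any avoids ∘ doubleOcc⇒pattern (perm-unique perm)))
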